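{- Let $G$ be a finite simple graph, $(\mathcal{C}_1,\ldots,\mathcal{C}_\ell)$ a local chordalization partition of a hole cover $\mathcal{C}$ of $G$, and $G^*=G_\ell^*$ the last graph in the corresponding chordalization chain. If a vertex set $K$ of $G$ forms a clique in $G^*$, then there exists a subset $\mathcal{C}^*\subseteq K\cap\mathcal{C}$ such that $K\setminus\mathcal{C}^*$ is a clique in $G$ and $|\mathcal{C}^*\cap\mathcal{C}_i|\le 1$ for each $i=1,\ldots,\ell$.
   Context: A hole is an induced cycle of length at least $4$; a graph is chordal if it has no hole. A nonempty set $X\subseteq V(G)$ is a hole cover of $G$ if every hole of $G$ contains a vertex of $X$ (for chordal $G$ any nonempty set is a hole cover). A vertex $u$ satisfies the NC property in $G$ if no hole of $G$ containing $u$ and hole of $G$ not containing $u$ share two consecutive edges; a set $\mathcal{C}$ satisfies the NC property in $G$ if each of its vertices does and every hole of $G$ contains at most one vertex of $\mathcal{C}$. Locally chordalizing a hole $H$ by a vertex $u$ on $H$ means adding an edge $uv$ for every vertex $v$ of $H$ not adjacent to $u$. For a hole cover $\mathcal{D}=\{u_1,\ldots,u_m\}$ of a graph $F$ satisfying the NC property in $F$, $\widehat{F}(\mathcal{D})$ is obtained from $F_0=F$ by letting $F_i$ be obtained from $F_{i-1}$ by locally chordalizing simultaneously all holes of $F_{i-1}$ containing $u_i$ by $u_i$, and taking $F_m$ (independent of ordering). An ordered partition $(\mathcal{C}_1,\ldots,\mathcal{C}_k)$ of a hole cover $\mathcal{C}$ of $G$ is a local chordalization partition if, setting $G_0=G_0^*=G-\mathcal{C}$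 and for $i=1,\ldots,k$ letting $V(G_i)=V(G_{i-1}^*)\cup\mathcal{C}_i$, $E(G_i)=E(G_{i-1}^*)\cup E(G-\bigcup_{j=i+1}^k\mathcal{C}_j)$, $G_i^*=\widehat{G_i}(\mathcal{C}_i)$, each $\mathcal{C}_i$ is a hole cover of $G_i$ satisfying the NC property in $G_i$ and each $G_i^*$ is chordal; the graphs $G_0,G_0^*,\ldots,G_k,G_k^*$ form the corresponding chordalization chain. -}

module Defs where

open import Data.Nat using (ℕ; zero; suc; _≤_; _<_; _<?_)
open import Data.Fin using (Fin; toℕ; fromℕ<)
open import Data.Fin.Subset using (Subset; _∈_; _∉_; _⊆_; _∩_; ⊥)
open import Data.Bool using (Bool; true; false; if_then_else_)
open import Data.Vec using (lookup)
open import Data.List using (List; foldl)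
open import Data.List using () renaming (allFin to allFinL)
open import Data.Product using (Σ; ∃; _×_; _,_)
open import Data.Sum using (_⊎_)
open import Data.Unit using (⊤)
open import Relation.Nullary using (¬_; yes; no)
open import Relation.Binary.PropositionalEquality using (_≡_; _≢_)
open import Function.Definitions using (Injective)
open import Function.Bundles using (_⇔_)

record SimpleGraph (n : ℕ) : Set where
  field
    adj   : Fin n → Fin n → Bool
    sym   : ∀ x y → adj x y ≡ adj y x
    irrefl : ∀ x → adj x x ≡ false
open SimpleGraph public

-- Auxiliary graphs arising in the chordalization chain: a vertex set
-- V ⊆ Fin n together with an edge relation.  Only the symmetrised,
-- loop-free restriction of E to V matters (see Adj).

record Gr (n : ℕ) : Set₁ where
  field
    V : Fin n → Set
    E : Fin n → Fin n → Set
open Gr public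

module _ {n : ℕ} where

  Adj : Gr n → Fin n → Fin n → Set
  Adj F x y = V F x × V F y × x ≢ y × (E F x y ⊎ E F y x)

  CycAdj : (k : ℕ) → Fin k → Fin k → Set
  CycAdj k i j = (suc (toℕ i) ≡ toℕ j) ⊎ (suc (toℕ i) ≡ k × toℕ j ≡ 0)

  CycNb : (k : ℕ) → Fin k → Fin k → Set
  CycNb k i j = CycAdj k i j ⊎ CycAdj k j i

  record Hole (F : Gr n) : Set where
    field
      len     : ℕ
      len≥4   : 4 ≤ len
      cyc     : Fin len → Fin n
      inj     : Injective _≡_ _≡_ cyc
      inV     : ∀ i → V F (cyc i)
      induced : ∀ i j → Adj F (cyc i) (cyc j) ⇔ CycNb len i j
  open Hole public

  OnHole : {F : Gr n} → Hole F → Fin n → Set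
  OnHole H v = ∃ λ i → cyc H i ≡ v

  HoleEdge : {F : Gr n} → Hole F → Fin n → Fin n → Set
  HoleEdge H a b = Σ (Fin (len H)) λ i → Σ (Fin (len H)) λ j →
                     CycNb (len H) i j × cyc H i ≡ a × cyc H j ≡ b

  Chordal : Gr n → Set
  Chordal F = ¬ Hole F

  HoleCover : Gr n → Subset n → Set
  HoleCover F X = (∃ λ x → x ∈ X) × (∀ x → x ∈ X → V F x)
                × (∀ (H : Hole F) → ∃ λ x → x ∈ X × OnHole H x)

  NCvertex : Gr n → Fin n → Set
  NCvertex F u = ∀ (H₁ H₂ : Hole F) → OnHole H₁ u → ¬ OnHole H₂ u →
    ¬ (Σ (Fin n) λ a → Σ (Fin n) λ b → Σ (Fin n) λ c → a ≢ c ×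
        HoleEdge H₁ a b × HoleEdge H₁ b c × HoleEdge H₂ a b × HoleEdge H₂ b c)

  NCset : Gr n → Subset n → Set
  NCset F X = (∀ u → u ∈ X → NCvertex F u)
            × (∀ (H : Hole F) x y → x ∈ X → y ∈ X → OnHole H x → OnHole H y → x ≡ y)

  chordalizeAt : Gr n → Fin n → Gr n
  chordalizeAt F u = record
    { V = V F
    ; E = λ x y → E F x y ⊎ (x ≡ u × Σ (Hole F) λ H → OnHole H u × OnHole H y) }

  hat : Gr n → Subset n → Gr n
  hat F D = foldl (λ F' v → if lookup D v then chordalizeAt F' v else F') F (allFinL n)

  full : SimpleGraph n → Gr n
  full G = record { V = λ _ → ⊤ ; E = λ x y → adj G x y ≡ true }

  CliqueG : SimpleGraph n → (Fin n → Set) → Set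
  CliqueG G K = ∀ x y → K x → K y → x ≢ y → adj G x y ≡ true

  CliqueGr : Gr n → Subset n → Set
  CliqueGr F K = ∀ x y → x ∈ K → y ∈ K → x ≢ y → Adj F x y

  -- Chordalization chain for an ordered partition
  -- part 0, …, part (ℓ-1)  (= 𝒞₁, …, 𝒞_ℓ in the paper) of C.

  module Chain (G : SimpleGraph n) (C : Subset n) (ℓ : ℕ) (part : Fin ℓ → Subset n) where

    -- 𝒞_{i+1} (paper indexing), empty if out of range
    partN : ℕ → Subset n
    partN i with i <? ℓ
    ... | yes p = part (fromℕ< p)
    ... | no _  = ⊥

    -- x lies in some 𝒞_j with j > m (paper indexing)
    Later : ℕ → Fin n → Set
    Later m x = ∃ λ (j : Fin ℓ) → m ≤ toℕ j × x ∈ part j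

    G₀ : Gr n
    G₀ = record { V = λ x → x ∉ C ; E = λ x y → adj G x y ≡ true }

    Gstar : ℕ → Gr n
    Gi    : ℕ → Gr n
    Gi zero = G₀
    Gi (suc i) = record
      { V = λ x → V (Gstar i) x ⊎ x ∈ partN i
      ; E = λ x y → E (Gstar i) x y
                   ⊎ (adj G x y ≡ true × ¬ Later (suc i) x × ¬ Later (suc i) y) }
    Gstar zero = G₀
    Gstar (suc i) = hat (Gi (suc i)) (partN i)

  IsLCP : SimpleGraph n → Subset n → (ℓ : ℕ) → (Fin ℓ → Subset n) → Set
  IsLCP G C ℓ part =
      HoleCover (full G) C
    × (∀ i → part i ⊆ C)
    × (∀ x → x ∈ C → ∃ λ i → x ∈ part i)
    × (∀ i j x → x ∈ part i → x ∈ part j → i ≡ j)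
    × (∀ (i : Fin ℓ) →
          HoleCover (Gi (suc (toℕ i))) (part i)
        × NCset (Gi (suc (toℕ i))) (part i)
        × Chordal (Gstar (suc (toℕ i))))
    where open Chain G C ℓ part

{-# OPTIONS --safe #-}
module Submission where

-- If u has the NC property in F and lies on a hole with t, then a connected set
-- that avoids u and does not touch t cannot touch both arcs of the hole from t
-- to u: a shortest detour through it would give a hole missing u but using both
-- hole edges at t.  Consequently chordalizing at u leaves no hole through u, the
-- holes of the chordalized graph are holes of F, and the new edges of F̂(D) join
-- some u ∈ D to vertices on holes of F through u.
--
-- Let K be a clique of F̂(D), and let us, vt be nonadjacent pairs of F inside K
-- with u ≠ v in D.  Either u v s t is an induced 4-cycle, or u and v both lie
-- on holes with a common vertex nonadjacent to them, and gluing one untouched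
-- arc of each of these holes along the edge uv gives a hole through u and v.
-- Both contradict NC.  So deleting a single vertex of D turns K into a clique
-- of F, and induction along the chain finishes the proof.
--
-- Adjacency in the chain quantifies over holes; it is treated as decidable
-- under a double negation, which the decidable conclusion removes.

open import Defs
open import Data.Nat using (ℕ; zero; suc; pred; _+_; _∸_; _≤_; _<_; _<?_; z≤n; s≤s; NonZero; >-nonZero; _≤′_; ≤′-refl; ≤′-step)
open import Data.Nat.Properties
open import Data.Nat.DivMod using (_%_; _mod_; n%n≡0; m%n%n≡m%n; [m+n]%n≡m%n; m%n<n; m<n⇒m%n≡m; %-distribˡ-+)
open import Data.Bool using (true; false; if_then_else_) renaming (_≟_ to _≟ᵇ_)
open import Data.Fin using (Fin; zero; suc; toℕ; fromℕ<)
open import Data.Fin.Properties using (toℕ<n; toℕ-fromℕ<; fromℕ<-toℕ; toℕ-injective; sequence; all?) renaming (_≟_ to _≟ᶠ_)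
open import Data.Fin.Subset using (Subset; _∈_; _∉_; _⊆_; _∩_; _∪_; ⁅_⁆) renaming (⊥ to ∅)
open import Data.Fin.Subset.Properties using (_∈?_; _⊆?_; anySubset?; ∉⊥; x∈⁅x⁆; x∈⁅y⁆⇒x≡y; x∈p∩q⁺; x∈p∪q⁺; x∈p∪q⁻)
open import Data.List using (List; []; _∷_; length; lookup; foldl; allFin)
open import Data.List.Relation.Unary.All as All using (All; []; _∷_)
open import Data.List.Relation.Unary.All.Properties using (¬Any⇒All¬)
open import Data.List.Relation.Unary.Any as Any using (Any; here; there; any?)
open import Data.List.Relation.Unary.Any.Properties using (lookup-index)
open import Data.List.Membership.Propositional.Properties using (∈-lookup)
open import Data.Vec using () renaming (lookup to lookupᵛ)
open import Data.Vec.Properties using (lookup⇒[]=)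
open import Data.Product using (Σ; ∃; _×_; _,_; proj₁; proj₂)
open import Data.Sum using (_⊎_; inj₁; inj₂; swap; [_,_]) renaming (map to ⊎-map)
open import Data.Empty using (⊥; ⊥-elim)
open import Effect.Monad using (RawMonad)
open import Function using (_∘_)
open import Function.Bundles using (mk⇔; Equivalence)
open import Relation.Nullary using (¬_; Dec; yes; no)
open import Relation.Nullary.Negation using (¬¬-Monad)
open import Relation.Nullary.Decidable using (_⊎-dec_; _×-dec_; _→-dec_; ¬?; ¬¬-excluded-middle; decidable-stable)
open import Relation.Binary.Construct.Closure.ReflexiveTransitive using (Star; ε; _◅_; _◅◅_; reverse)
open import Relation.Binary.PropositionalEquality using (_≡_; _≢_; refl; cong; trans; subst) renaming (sym to ≡-sym)

-- Walks, induced paths and holes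

module _ {n : ℕ} (F : Gr n) where

  Adj-sym : ∀ {x y} → Adj F x y → Adj F y x
  Adj-sym (vx , vy , x≢y , e) = vy , vx , x≢y ∘ ≡-sym , swap e

  HoleEdge⇒Adj : (H : Hole F) → ∀ {a b} → HoleEdge H a b → Adj F a b
  HoleEdge⇒Adj H (i , j , nb , refl , refl) = Equivalence.from (induced H i j) nb

  HoleEdge-sym : (H : Hole F) → ∀ {a b} → HoleEdge H a b → HoleEdge H b a
  HoleEdge-sym H (i , j , nb , p , q) = j , i , swap nb , q , p

  HoleEdge⇒OnHole : (H : Hole F) → ∀ {a b} → HoleEdge H a b → OnHole H a
  HoleEdge⇒OnHole H (i , _ , _ , p , _) = i , p

  Touch : Fin n → Fin n → Set
  Touch x y = x ≡ y ⊎ Adj F x y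

  Touch-sym : ∀ {x y} → Touch x y → Touch y x
  Touch-sym (inj₁ p) = inj₁ (≡-sym p)
  Touch-sym (inj₂ p) = inj₂ (Adj-sym p)

  -- Membership is recorded at the ends of each step, so an empty walk says nothing about the set;
  -- lemmas that need the start inside it ask for that separately.
  Walk : (Fin n → Set) → Fin n → Fin n → Set
  Walk S = Star (λ x y → S x × S y × Adj F x y)

  Walk-sym : ∀ {S x y} → Walk S x y → Walk S y x
  Walk-sym = reverse (λ (sx , sy , e) → sy , sx , Adj-sym e)

  Walk-⊆ : ∀ {S T : Fin n → Set} → (∀ {x} → S x → T x) → ∀ {x y} → Walk S x y → Walk T x y
  Walk-⊆ f ε = ε
  Walk-⊆ f ((sx , sy , e) ◅ w) = (f sx , f sy , e) ◅ Walk-⊆ f w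

  touch-walk : ∀ {S : Fin n → Set} {x y} → S x → S y → Touch x y → Walk S x y
  touch-walk sx sy (inj₁ refl) = ε
  touch-walk sx sy (inj₂ e) = (sx , sy , e) ◅ ε

  -- The end lies in `B`, so it cannot lie in `A`: the walk has to leave `A`, and it cannot step
  -- from `A` straight into `B`.
  walk-crosses : ∀ {T A B Y : Fin n → Set} → (∀ {x} → T x → A x ⊎ Y x ⊎ B x) →
    (∀ {x y} → A x → B y → ¬ Touch x y) →
    ∀ {x y} → T x → A x → B y → Walk T x y → ∃ λ z → T z × Y z
  walk-crosses cover apart tx ax bx ε = ⊥-elim (apart ax bx (inj₁ refl))
  walk-crosses cover apart tx ax by ((_ , tz , e) ◅ w) with cover tz
  ... | inj₁ az = walk-crosses cover apart tz az by w
  ... | inj₂ (inj₁ yz) = _ , tz , yz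
  ... | inj₂ (inj₂ bz) = ⊥-elim (apart ax bz (inj₂ e))

  -- The list omits the first vertex, so all vertices are `a ∷ xs`. Forbidding `Touch` instead of
  -- `Adj` also makes them distinct.
  data InducedPath : Fin n → List (Fin n) → Fin n → Set where
    single : ∀ a → InducedPath a [] a
    link : ∀ {a y ys b} → Adj F a y → All (λ z → ¬ Touch a z) ys →
      InducedPath y ys b → InducedPath a (y ∷ ys) b

  path-adj : ∀ {a xs b} → InducedPath a xs b → ∀ i j →
    suc (toℕ i) ≡ toℕ j → Adj F (lookup (a ∷ xs) i) (lookup (a ∷ xs) j)
  path-adj (single a) zero zero ()
  path-adj (link e _ p) zero zero ()
  path-adj (link e _ p) zero (suc zero) q = e
  path-adj (link e _ p) zero (suc (suc j)) ()
  path-adj (link e _ p) (suc i) (suc j) q = path-adj p i j (suc-injective q)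

  path-touch : ∀ {a xs b} → InducedPath a xs b → ∀ i j →
    Touch (lookup (a ∷ xs) i) (lookup (a ∷ xs) j) →
    i ≡ j ⊎ suc (toℕ i) ≡ toℕ j ⊎ suc (toℕ j) ≡ toℕ i
  path-touch p zero zero t = inj₁ refl
  path-touch (link e _ p) zero (suc zero) t = inj₂ (inj₁ refl)
  path-touch (link e none p) zero (suc (suc j)) t = ⊥-elim (All.lookup none (∈-lookup j) t)
  path-touch (link e _ p) (suc zero) zero t = inj₂ (inj₂ refl)
  path-touch (link e none p) (suc (suc j)) zero t = ⊥-elim (All.lookup none (∈-lookup j) (Touch-sym t))
  path-touch (link e _ p) (suc i) (suc j) t with path-touch p i j t
  ... | inj₁ q = inj₁ (cong suc q)
  ... | inj₂ (inj₁ q) = inj₂ (inj₁ (cong suc q))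
  ... | inj₂ (inj₂ q) = inj₂ (inj₂ (cong suc q))

  path-≢ : ∀ {a xs b} → InducedPath a xs b → ∀ i j →
    lookup (a ∷ xs) i ≡ lookup (a ∷ xs) j → suc (toℕ i) ≢ toℕ j
  path-≢ p i j q r = proj₁ (proj₂ (proj₂ (path-adj p i j r))) q

  -- Equality is a case of `Touch`, so equal vertices have equal or consecutive indices; consecutive
  -- vertices are adjacent, hence distinct.
  path-injective : ∀ {a xs b} → InducedPath a xs b → ∀ i j →
    lookup (a ∷ xs) i ≡ lookup (a ∷ xs) j → i ≡ j
  path-injective p i j q with path-touch p i j (inj₁ q)
  ... | inj₁ r = r
  ... | inj₂ (inj₁ r) = ⊥-elim (path-≢ p i j q r)
  ... | inj₂ (inj₂ r) = ⊥-elim (path-≢ p j i (≡-sym q) r)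

  path-last : ∀ {a xs b} → InducedPath a xs b →
    ∃ λ i → toℕ i ≡ length xs × lookup (a ∷ xs) i ≡ b
  path-last (single a) = zero , refl , refl
  path-last (link _ _ p) = let i , q , r = path-last p in suc i , cong suc q , r

  path-walk : ∀ {T : Fin n → Set} {a xs b} → InducedPath a xs b → All T (a ∷ xs) → Walk T a b
  path-walk (single a) _ = ε
  path-walk (link e _ p) (ta ∷ ty ∷ ts) = (ta , ty , e) ◅ path-walk p (ty ∷ ts)

  path-length≥3 : ∀ {a xs b} → InducedPath a xs b → ¬ Touch a b → 3 ≤ length (a ∷ xs)
  path-length≥3 (single a) a≁b = ⊥-elim (a≁b (inj₁ refl))
  path-length≥3 (link e _ (single _)) a≁b = ⊥-elim (a≁b (inj₂ e))
  path-length≥3 (link _ _ (link _ _ _)) _ = s≤s (s≤s (s≤s z≤n))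

  module _ {c a b xs} (p : InducedPath a xs b) (c∼a : Adj F c a) (c∼b : Adj F c b)
           (c∉ : All (c ≢_) (a ∷ xs)) (only : All (λ x → Adj F c x → x ≡ a ⊎ x ≡ b) (a ∷ xs))
           (a≁b : ¬ Touch a b) where

    private
      N : ℕ
      N = suc (suc (length xs))

      vertex : Fin N → Fin n
      vertex = lookup (c ∷ a ∷ xs)

      vertex-injective : ∀ {i j} → vertex i ≡ vertex j → i ≡ j
      vertex-injective {zero} {zero} _ = refl
      vertex-injective {zero} {suc j} q = ⊥-elim (All.lookup c∉ (∈-lookup j) q)
      vertex-injective {suc i} {zero} q = ⊥-elim (All.lookup c∉ (∈-lookup i) (≡-sym q))
      vertex-injective {suc i} {suc j} q = cong suc (path-injective p i j q)

      CycAdj⇒Adj : ∀ i j → CycAdj {n} N i j → Adj F (vertex i) (vertex j)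
      CycAdj⇒Adj zero zero (inj₁ ())
      CycAdj⇒Adj zero (suc zero) (inj₁ q) = c∼a
      CycAdj⇒Adj zero (suc (suc j)) (inj₁ ())
      CycAdj⇒Adj zero j (inj₂ (() , _))
      -- The wrap-around edge: `suc i` is the largest index, so its vertex is the end `b` of the
      -- path.
      CycAdj⇒Adj (suc i) zero (inj₂ (q , _)) =
        let k , k≡ , v≡b = path-last p
            i≡k = toℕ-injective (trans (suc-injective (suc-injective q)) (≡-sym k≡))
        in Adj-sym (subst (Adj F c) (≡-sym (trans (cong (lookup (a ∷ xs)) i≡k) v≡b)) c∼b)
      CycAdj⇒Adj (suc i) (suc j) (inj₁ q) = path-adj p i j (suc-injective q)

      from-centre : ∀ j → Adj F c (lookup (a ∷ xs) j) → CycNb {n} N zero (suc j)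
      from-centre j e with All.lookup only (∈-lookup j) e
      ... | inj₁ q = inj₁ (inj₁ (cong (λ h → suc (toℕ h)) (path-injective p zero j (≡-sym q))))
      ... | inj₂ q =
        let k , k≡ , v≡b = path-last p
            j≡k = path-injective p j k (trans q (≡-sym v≡b))
        in inj₂ (inj₂ (cong (λ h → suc (suc h)) (trans (cong toℕ j≡k) k≡) , refl))

      Adj⇒CycNb : ∀ i j → Adj F (vertex i) (vertex j) → CycNb {n} N i j
      Adj⇒CycNb zero zero (_ , _ , c≢c , _) = ⊥-elim (c≢c refl)
      Adj⇒CycNb zero (suc j) e = from-centre j e
      Adj⇒CycNb (suc i) zero e = swap (from-centre i (Adj-sym e))
      Adj⇒CycNb (suc i) (suc j) e with path-touch p i j (inj₂ e)
      ... | inj₁ refl = ⊥-elim (proj₁ (proj₂ (proj₂ e)) refl)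
      ... | inj₂ (inj₁ q) = inj₁ (inj₁ (cong suc q))
      ... | inj₂ (inj₂ q) = inj₂ (inj₁ (cong suc q))

      vertex-V : ∀ i → V F (vertex i)
      vertex-V zero = proj₁ c∼a
      vertex-V (suc zero) = proj₁ (proj₂ c∼a)
      vertex-V (suc (suc i)) = path-V p i
        where
        path-V : ∀ {a xs b} → InducedPath a xs b → ∀ i → V F (lookup xs i)
        path-V (link e _ p) zero = proj₁ (proj₂ e)
        path-V (link e _ p) (suc i) = path-V p i

    -- The centre `c` takes index 0 and the path the others. Ends that do not touch force three path
    -- vertices, hence length at least four.
    closePath : Hole F
    closePath = record
      { len = N ; len≥4 = s≤s (path-length≥3 p a≁b) ; cyc = vertex
      ; inj = vertex-injective ; inV = vertex-V
      ; induced = λ i j → mk⇔ (Adj⇒CycNb i j)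
          λ { (inj₁ q) → CycAdj⇒Adj i j q ; (inj₂ q) → Adj-sym (CycAdj⇒Adj j i q) } }

    closePath-first : HoleEdge closePath c a
    closePath-first = zero , suc zero , inj₁ (inj₁ refl) , refl , refl

    closePath-last : HoleEdge closePath c b
    closePath-last = let k , k≡ , v≡b = path-last p in
      zero , suc k , inj₂ (inj₂ (cong (λ h → suc (suc h)) k≡ , refl)) , refl , v≡b

  module _ (adj? : ∀ x y → Dec (Adj F x y)) where

    touch? : ∀ x y → Dec (Touch x y)
    touch? x y = (x ≟ᶠ y) ⊎-dec adj? x y

    -- The path is cut at the last vertex that `x` touches, so beyond the new second vertex nothing
    -- touches `x`. If `x` equals that vertex, the remaining path is kept as it is.
    prepend : ∀ {S : Fin n → Set} {x a xs b} → S x → All S (a ∷ xs) → InducedPath a xs b →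
      Touch x a ⊎ Any (Touch x) xs → ∃ λ ys → All S (x ∷ ys) × InducedPath x ys b
    prepend sx s (single a) (inj₁ (inj₁ refl)) = [] , s , single a
    prepend sx s (single a) (inj₁ (inj₂ e)) = _ , sx ∷ s , link e [] (single a)
    prepend {x = x} {xs = y ∷ ys} sx s p@(link _ _ q) t with any? (touch? x) (y ∷ ys) | t
    ... | yes (here u) | _ = prepend sx (All.tail s) q (inj₁ u)
    ... | yes (there u) | _ = prepend sx (All.tail s) q (inj₂ u)
    ... | no ¬u | inj₂ u = ⊥-elim (¬u u)
    ... | no ¬u | inj₁ (inj₁ refl) = _ , s , p
    ... | no ¬u | inj₁ (inj₂ e) = _ , sx ∷ s , link e (¬Any⇒All¬ _ ¬u) p

    walk⇒path : ∀ {S : Fin n → Set} {a b} → S a → Walk S a b →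
      ∃ λ xs → All S (a ∷ xs) × InducedPath a xs b
    walk⇒path sa ε = [] , sa ∷ [] , single _
    walk⇒path sa ((_ , sy , e) ◅ w) =
      let ys , s , p = walk⇒path sy w in prepend sa s p (inj₁ (inj₂ e))

    -- `around` is the hole with `c` deleted, presented as a walk so that `walk-crosses` can locate
    -- hole vertices of a prescribed kind.
    record HoleThrough (c a b : Fin n) (S : Fin n → Set) : Set where
      field
        hole  : Hole F
        edge₁ : HoleEdge hole c a
        edge₂ : HoleEdge hole c b
        inside : ∀ {x} → OnHole hole x → x ≡ c ⊎ S x
        around : Walk (λ x → OnHole hole x × S x) a b

    -- Thinning the walk to an induced path from `a` to `b` inside `S` and closing it at `c` creates
    -- no chord, since `a` and `b` are the only neighbours of `c` in `S`.
    holeThrough : ∀ {c a b} (S : Fin n → Set) → ¬ S c → S a → Adj F c a → Adj F c b →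
      ¬ Touch a b → (∀ x → S x → Adj F c x → x ≡ a ⊎ x ≡ b) → Walk S a b → HoleThrough c a b S
    holeThrough {c} {a} S c∉S sa c∼a c∼b a≁b only w = record
      { hole = H
      ; edge₁ = closePath-first p c∼a c∼b c∉ only′ a≁b
      ; edge₂ = closePath-last p c∼a c∼b c∉ only′ a≁b
      ; inside = λ { (zero , refl) → inj₁ refl ; (suc i , refl) → inj₂ (All.lookup s (∈-lookup i)) }
      ; around = path-walk p (All.tabulate λ x∈ →
          (suc (Any.index x∈) , ≡-sym (lookup-index x∈)) , All.lookup s x∈) }
      where
      found = walk⇒path sa w
      xs = proj₁ found
      s = proj₁ (proj₂ found)
      p = proj₂ (proj₂ found)
      c∉ : All (c ≢_) (a ∷ xs)
      c∉ = All.map (λ {x} sx c≡x → c∉S (subst S (≡-sym c≡x) sx)) s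
      only′ = All.map (λ {x} → only x) s
      H = closePath p c∼a c∼b c∉ only′ a≁b

  -- Cyclic listings of a hole and its arcs

  module _ (H : Hole F) where
    private
      N = len H
      instance
        N≢0 : NonZero N
        N≢0 = >-nonZero (≤-trans (s≤s z≤n) (len≥4 H))

      %-+ : ∀ a b → (a % N + b) % N ≡ (a + b) % N
      %-+ a b = trans (%-distribˡ-+ (a % N) b N)
        (trans (cong (λ h → (h + b % N) % N) (m%n%n≡m%n a N)) (≡-sym (%-distribˡ-+ a b N)))

      suc-% : ∀ a → suc (a % N) % N ≡ suc a % N
      suc-% a = trans (cong (_% N) (+-comm 1 (a % N))) (trans (%-+ a 1) (cong (_% N) (+-comm a 1)))

      -- Modulo `N` the two cases of `CycAdj` become one successor equation, which is easy to
      -- rotate.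
      CycAdj⇒% : ∀ {i j : Fin N} → CycAdj {n} N i j → suc (toℕ i) % N ≡ toℕ j
      CycAdj⇒% {j = j} (inj₁ q) = trans (cong (_% N) q) (m<n⇒m%n≡m (toℕ<n j))
      CycAdj⇒% (inj₂ (q , r)) = trans (cong (_% N) q) (trans (n%n≡0 N) (≡-sym r))

      %⇒CycAdj : ∀ {i j : Fin N} → suc (toℕ i) % N ≡ toℕ j → CycAdj {n} N i j
      %⇒CycAdj {i} q with m≤n⇒m<n∨m≡n (toℕ<n i)
      ... | inj₁ lt = inj₁ (trans (≡-sym (m<n⇒m%n≡m lt)) q)
      ... | inj₂ eq = inj₂ (eq , trans (≡-sym q) (trans (cong (_% N) eq) (n%n≡0 N)))

    -- A listing of H by all of ℕ, periodic with period len H.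
    record Rotation (u : Fin n) : Set where
      field
        z     : ℕ → Fin n
        z0    : z 0 ≡ u
        zN    : z N ≡ u
        edge  : ∀ i → HoleEdge H (z i) (z (suc i))
        inj-z : ∀ {i j} → i < N → j < N → z i ≡ z j → i ≡ j
        adj-z : ∀ {i j} → i < N → j < N → Adj F (z i) (z j) →
          (suc i ≡ j ⊎ (suc i ≡ N × j ≡ 0)) ⊎ (suc j ≡ i ⊎ (suc j ≡ N × i ≡ 0))
        onto  : ∀ {x} → OnHole H x → ∃ λ i → i < N × z i ≡ x

    rotation : ∀ {u} → OnHole H u → Rotation u
    rotation {u} (i₀ , refl) = record
      { z = λ i → cyc H (idx i)
      ; z0 = cong (cyc H) (toℕ-injective (trans (toℕ-idx 0)
          (trans (cong (_% N) (+-identityʳ o)) (m<n⇒m%n≡m (toℕ<n i₀)))))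
      ; zN = cong (cyc H) (toℕ-injective (trans (toℕ-idx N)
          (trans ([m+n]%n≡m%n o N) (m<n⇒m%n≡m (toℕ<n i₀)))))
      ; edge = λ i → idx i , idx (suc i) , inj₁ (%⇒CycAdj (succ i)) , refl , refl
      ; inj-z = λ i< j< q → idx-injective i< j< (inj H q)
      ; adj-z = λ {i} {j} i< j< e → back-adj i< j< (Equivalence.to (induced H (idx i) (idx j)) e)
      ; onto = λ { (k , refl) → (toℕ k + (N ∸ o)) % N , m%n<n _ N , cong (cyc H) (toℕ-injective (idx-onto k)) } }
      where
      o = toℕ i₀
      o≤N = <⇒≤ (toℕ<n i₀)
      idx : ℕ → Fin N
      idx i = (o + i) mod N
      toℕ-idx : ∀ i → toℕ (idx i) ≡ (o + i) % N
      toℕ-idx i = toℕ-fromℕ< (m%n<n (o + i) N)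
      succ : ∀ i → suc (toℕ (idx i)) % N ≡ toℕ (idx (suc i))
      succ i = trans (cong (λ h → suc h % N) (toℕ-idx i))
        (trans (suc-% (o + i)) (trans (cong (_% N) (≡-sym (+-suc o i))) (≡-sym (toℕ-idx (suc i)))))
      -- Adding `N ∸ o` undoes the offset `o` modulo `N`; this gives both injectivity and
      -- surjectivity of the listing.
      unshift : ∀ i → (toℕ (idx i) + (N ∸ o)) % N ≡ i % N
      unshift i = trans (cong (λ h → (h + (N ∸ o)) % N) (toℕ-idx i))
        (trans (%-+ (o + i) (N ∸ o)) (trans (cong (_% N) around) ([m+n]%n≡m%n i N)))
        where
        around : o + i + (N ∸ o) ≡ i + N
        around = trans (cong (_+ (N ∸ o)) (+-comm o i))
          (trans (+-assoc i o (N ∸ o)) (cong (i +_) (m+[n∸m]≡n o≤N)))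
      idx-injective : ∀ {i j} → i < N → j < N → idx i ≡ idx j → i ≡ j
      idx-injective {i} {j} i< j< q = trans (≡-sym (m<n⇒m%n≡m i<))
        (trans (≡-sym (unshift i)) (trans (cong (λ h → (toℕ h + (N ∸ o)) % N) q)
          (trans (unshift j) (m<n⇒m%n≡m j<))))
      idx-onto : ∀ k → toℕ (idx ((toℕ k + (N ∸ o)) % N)) ≡ toℕ k
      idx-onto k = trans (toℕ-idx _) (trans (cong (_% N) (+-comm o _))
        (trans (%-+ (toℕ k + (N ∸ o)) o) (trans (cong (_% N) around)
          (trans ([m+n]%n≡m%n (toℕ k) N) (m<n⇒m%n≡m (toℕ<n k))))))
        where
        around : toℕ k + (N ∸ o) + o ≡ toℕ k + N
        around = trans (+-assoc (toℕ k) (N ∸ o) o) (cong (toℕ k +_) (m∸n+n≡m o≤N))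
      back : ∀ {i j} → i < N → j < N → CycAdj {n} N (idx i) (idx j) → suc i ≡ j ⊎ (suc i ≡ N × j ≡ 0)
      back {i} {j} i< j< q with m≤n⇒m<n∨m≡n i<
      ... | inj₁ lt = inj₁ (idx-injective lt j<
              (toℕ-injective (trans (≡-sym (succ i)) (CycAdj⇒% q))))
      ... | inj₂ eq = inj₂ (eq , trans (≡-sym (m<n⇒m%n≡m j<)) (trans (≡-sym (unshift j))
              (trans (cong (λ h → (h + (N ∸ o)) % N) (≡-sym (trans (≡-sym (succ i)) (CycAdj⇒% q))))
                (trans (unshift (suc i)) (trans (cong (_% N) eq) (n%n≡0 N))))))
      back-adj : ∀ {i j} → i < N → j < N → CycNb {n} N (idx i) (idx j) →
        (suc i ≡ j ⊎ (suc i ≡ N × j ≡ 0)) ⊎ (suc j ≡ i ⊎ (suc j ≡ N × i ≡ 0))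
      back-adj i< j< (inj₁ q) = inj₁ (back i< j< q)
      back-adj i< j< (inj₂ q) = inj₂ (back j< i< q)

    module _ {u} (R : Rotation u) where
      open Rotation R

      Arc : ℕ → ℕ → Fin n → Set
      Arc lo hi x = ∃ λ i → lo ≤ i × i ≤ hi × z i ≡ x

      private
        arc-up : ∀ {lo hi i j} → lo ≤ i → j ≤ hi → i ≤′ j → Walk (Arc lo hi) (z i) (z j)
        arc-up l h ≤′-refl = ε
        arc-up l h (≤′-step {j} k) = arc-up l (<⇒≤ h) k ◅◅
          ( (j , ≤-trans l (≤′⇒≤ k) , <⇒≤ h , refl)
          , (suc j , ≤-trans l (≤-trans (≤′⇒≤ k) (n≤1+n j)) , h , refl)
          , HoleEdge⇒Adj H (edge j)) ◅ ε

      arc-walk : ∀ {lo hi x y} → Arc lo hi x → Arc lo hi y → Walk (Arc lo hi) x y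
      arc-walk (i , l , h , refl) (j , l′ , h′ , refl) with ≤-total i j
      ... | inj₁ q = arc-up l h′ (≤⇒≤′ q)
      ... | inj₂ q = Walk-sym (arc-up l′ h (≤⇒≤′ q))

      adj-base : ∀ {i} → 0 < i → i < N → Adj F u (z i) → i ≡ 1 ⊎ suc i ≡ N
      adj-base {i} 0<i i<N e with adj-z (≤-trans (s≤s z≤n) i<N) i<N (subst (λ v → Adj F v (z i)) (≡-sym z0) e)
      ... | inj₁ (inj₁ q) = inj₁ (≡-sym q)
      ... | inj₁ (inj₂ (_ , q)) = ⊥-elim (<⇒≢ 0<i (≡-sym q))
      ... | inj₂ (inj₂ (q , _)) = inj₂ q

      arc-∌-base : ∀ {lo hi} → 0 < lo → hi < N → ¬ Arc lo hi u
      arc-∌-base 0<lo hi<N (i , l , h , q) = <⇒≢ (≤-trans 0<lo l)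
        (inj-z (≤-trans (s≤s z≤n) hi<N) (≤-<-trans h hi<N) (trans z0 (≡-sym q)))

-- Sides of a vertex with the NC property

module _ {n : ℕ} (F : Gr n) (u : Fin n) where

  -- This is the neighbourhood of `u` after chordalizing at `u`, by `chordalized⇒Reach` and
  -- `Reach⇒chordalized`.
  Reach : Fin n → Set
  Reach t = Adj F u t ⊎ (u ≢ t × Σ (Hole F) λ H → OnHole H u × OnHole H t)

  Reach⇒≢ : ∀ {t} → Reach t → u ≢ t
  Reach⇒≢ (inj₁ (_ , _ , u≢t , _)) = u≢t
  Reach⇒≢ (inj₂ (u≢t , _)) = u≢t

  -- A connected set containing t through which t is linked to u by the single
  -- neighbour end of u, such as an arc from t to u with u removed.
  record Side (t : Fin n) : Set₁ where
    field
      S     : Fin n → Set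
      end   : Fin n
      S-t   : S t
      S-end : S end
      u∼end : Adj F u end
      only  : ∀ {x} → S x → Adj F u x → x ≡ end
      u∉S   : ¬ S u
      walk  : ∀ {x y} → S x → S y → Walk F S x y

  open Side

  Apart : (Fin n → Set) → (Fin n → Set) → Set
  Apart A B = ∀ {x y} → A x → B y → ¬ Touch F x y

  trivialSide : ∀ {t} → Adj F u t → Side t
  trivialSide {t} u∼t = record
    { S = _≡ t ; end = t ; S-t = refl ; S-end = refl ; u∼end = u∼t
    ; only = λ q _ → q ; u∉S = λ q → proj₁ (proj₂ (proj₂ u∼t)) q
    ; walk = λ { refl refl → ε } }

  module _ (adj? : ∀ x y → Dec (Adj F x y)) (nc : NCvertex F u) where

    module _ {t} (u≢t : u ≢ t) (u≁t : ¬ Adj F u t) (H : Hole F) (u∈H : OnHole H u) (t∈H : OnHole H t) where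
      private
        R = rotation F H u∈H
        open Rotation R
        N = len H
        M = pred N
        1+M : suc M ≡ N
        1+M = suc-pred N {{>-nonZero (≤-trans (s≤s z≤n) (len≥4 H))}}
        M<N : M < N
        M<N = ≤-reflexive 1+M
        j = proj₁ (onto t∈H)
        j<N : j < N
        j<N = proj₁ (proj₂ (onto t∈H))
        zj : z j ≡ t
        zj = proj₂ (proj₂ (onto t∈H))
        0<j : 0 < j
        0<j = n≢0⇒n>0 λ j≡0 → u≢t (trans (≡-sym z0) (trans (cong z (≡-sym j≡0)) zj))
        j≤M : j ≤ M
        j≤M = ≤-pred (≤-trans j<N (≤-reflexive (≡-sym 1+M)))

        leftSide : Side t
        leftSide = record
          { S = Arc F H R 1 j ; end = z 1 ; S-t = j , 0<j , ≤-refl , zj ; S-end = 1 , ≤-refl , 0<j , refl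
          ; u∼end = subst (λ v → Adj F v (z 1)) z0 (HoleEdge⇒Adj F H (edge 0))
          ; only = only-left
          ; u∉S = arc-∌-base F H R (s≤s z≤n) j<N
          ; walk = arc-walk F H R }
          where
          only-left : ∀ {x} → Arc F H R 1 j x → Adj F u x → x ≡ z 1
          only-left (i , 0<i , i≤j , refl) e with adj-base F H R 0<i (≤-<-trans i≤j j<N) e
          ... | inj₁ q = cong z q
          -- The other hole neighbour of `u` has the largest index and lies on this arc only if it
          -- is `t`, which is not adjacent to `u`.
          ... | inj₂ q = ⊥-elim (u≁t (subst (Adj F u) (trans (cong z i≡j) zj) e))
            where
            i≡j : i ≡ j
            i≡j = ≤-antisym i≤j (≤-pred (≤-trans j<N (≤-reflexive (≡-sym q))))

        rightSide : Side t
        rightSide = record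
          { S = Arc F H R j M ; end = z M ; S-t = j , ≤-refl , j≤M , zj ; S-end = M , j≤M , ≤-refl , refl
          ; u∼end = subst (λ v → Adj F v (z M)) (trans (cong z 1+M) zN)
              (Adj-sym F (HoleEdge⇒Adj F H (edge M)))
          ; only = only-right
          ; u∉S = arc-∌-base F H R 0<j M<N
          ; walk = arc-walk F H R }
          where
          only-right : ∀ {x} → Arc F H R j M x → Adj F u x → x ≡ z M
          only-right (i , j≤i , i≤M , refl) e
            with adj-base F H R (≤-trans 0<j j≤i) (≤-<-trans i≤M M<N) e
          ... | inj₂ q = cong z (suc-injective (trans q (≡-sym 1+M)))
          ... | inj₁ q = ⊥-elim (u≁t (subst (Adj F u) (trans (cong z i≡j) zj) e))
            where
            i≡j : i ≡ j
            i≡j = ≤-antisym (≤-trans (≤-reflexive q) 0<j) j≤i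

      module _ {P : Fin n → Set} (P-walk : ∀ {x y} → P x → P y → Walk F P x y)
               (u∉P : ¬ P u) (P∌t : ∀ {x} → P x → ¬ Touch F x t) where
        private
          -- The detour runs from one hole neighbour of `t` back along its arc to `z i`, through `P`
          -- to `z i′`, and along the other arc to the other hole neighbour of `t`. It avoids `u`,
          -- and `t` is adjacent to nothing else that it may use.
          not-both : ∀ {i i′ y y′} → 0 < i → i ≤ j → P y → Touch F (z i) y →
            j ≤ i′ → i′ ≤ M → P y′ → Touch F (z i′) y′ → ⊥
          not-both {i} {i′} {y} {y′} 0<i i≤j py ty j≤i′ i′≤M py′ ty′ =
            go j refl (≤∧≢⇒< i≤j i≢j) (≤∧≢⇒< j≤i′ j≢i′)
            where
            i≢j : i ≢ j
            i≢j q = P∌t py (Touch-sym F (subst (λ v → Touch F v y) (trans (cong z q) zj) ty))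
            j≢i′ : j ≢ i′
            j≢i′ q = P∌t py′ (Touch-sym F (subst (λ v → Touch F v y′) (trans (cong z (≡-sym q)) zj) ty′))
            -- With `j` written as `suc k`, the hole neighbours of `t` are `z k` and
            -- `z (suc (suc k))`.
            go : ∀ k → k ≡ j → i < k → j < i′ → ⊥
            go (suc k) k≡j (s≤s i≤k) j<i′ =
              nc H (HoleThrough.hole h) u∈H u∉h
                ( z k , z (suc k) , z (suc (suc k)) , (λ q → k≁ (inj₁ q)) , edge k , edge (suc k)
                , HoleEdge-sym F (HoleThrough.hole h) (HoleThrough.edge₁ h) , HoleThrough.edge₂ h )
              where
              zk : z (suc k) ≡ t
              zk = trans (cong z k≡j) zj
              0<k : 0 < k
              0<k = ≤-trans 0<i i≤k
              ssk≤M : suc (suc k) ≤ M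
              ssk≤M = ≤-trans (≤-trans (≤-reflexive (cong suc k≡j)) j<i′) i′≤M
              sk<N : suc k < N
              sk<N = ≤-trans ssk≤M (<⇒≤ M<N)
              ssk<N : suc (suc k) < N
              ssk<N = ≤-<-trans ssk≤M M<N
              k<N : k < N
              k<N = <⇒≤ sk<N
              S′ : Fin n → Set
              S′ x = (Arc F H R 1 k x ⊎ Arc F H R (suc (suc k)) M x) ⊎ P x
              k≁ : ¬ Touch F (z k) (z (suc (suc k)))
              k≁ (inj₁ q) = <⇒≢ (s≤s (n≤1+n k)) (inj-z k<N ssk<N q)
              k≁ (inj₂ e) with adj-z k<N ssk<N e
              ... | inj₁ (inj₁ q) = 1+n≢n (≡-sym (suc-injective q))
              ... | inj₁ (inj₂ (_ , ()))
              ... | inj₂ (inj₁ q) = <⇒≢ (≤-trans (n<1+n k) (≤-trans (n≤1+n _) (n≤1+n _))) (≡-sym q)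
              ... | inj₂ (inj₂ (_ , q)) = <⇒≢ 0<k (≡-sym q)
              neighbour : ∀ {l} → 0 < l → l < N → Adj F (z (suc k)) (z l) → z l ≡ z k ⊎ z l ≡ z (suc (suc k))
              neighbour 0<l l<N e with adj-z sk<N l<N e
              ... | inj₁ (inj₁ q) = inj₂ (cong z (≡-sym q))
              ... | inj₁ (inj₂ (_ , q)) = ⊥-elim (<⇒≢ 0<l (≡-sym q))
              ... | inj₂ (inj₁ q) = inj₁ (cong z (suc-injective q))
              t∉S′ : ¬ S′ (z (suc k))
              t∉S′ (inj₁ (inj₁ (l , _ , l≤k , q))) =
                <⇒≢ (s≤s l≤k) (inj-z (≤-<-trans l≤k k<N) sk<N q)
              t∉S′ (inj₁ (inj₂ (l , sk<l , l≤M , q))) =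
                <⇒≢ sk<l (≡-sym (inj-z (≤-<-trans l≤M M<N) sk<N q))
              t∉S′ (inj₂ p) = P∌t p (inj₁ zk)
              only′ : ∀ x → S′ x → Adj F (z (suc k)) x → x ≡ z k ⊎ x ≡ z (suc (suc k))
              only′ x (inj₁ (inj₁ (l , 0<l , l≤k , refl))) e = neighbour 0<l (≤-<-trans l≤k k<N) e
              only′ x (inj₁ (inj₂ (l , k<l , l≤M , refl))) e =
                neighbour (≤-trans (s≤s z≤n) k<l) (≤-<-trans l≤M M<N) e
              only′ x (inj₂ p) e = ⊥-elim (P∌t p (inj₂ (Adj-sym F (subst (λ v → Adj F v x) zk e))))
              left : ∀ {l} → 0 < l → l ≤ k → S′ (z l)
              left 0<l l≤k = inj₁ (inj₁ (_ , 0<l , l≤k , refl))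
              sk<i′ : suc k < i′
              sk<i′ = ≤-trans (≤-reflexive (cong suc k≡j)) j<i′
              right : ∀ {l} → suc k < l → l ≤ M → S′ (z l)
              right a b = inj₁ (inj₂ (_ , a , b , refl))
              detour : Walk F S′ (z k) (z (suc (suc k)))
              detour =
                Walk-⊆ F (λ a → inj₁ (inj₁ a)) (arc-walk F H R (k , 0<k , ≤-refl , refl) (i , 0<i , i≤k , refl))
                ◅◅ touch-walk F (left 0<i i≤k) (inj₂ py) ty
                ◅◅ Walk-⊆ F inj₂ (P-walk py py′)
                ◅◅ touch-walk F (inj₂ py′) (right sk<i′ i′≤M) (Touch-sym F ty′)
                ◅◅ Walk-⊆ F (λ a → inj₁ (inj₂ a))
                     (arc-walk F H R (i′ , sk<i′ , i′≤M , refl) (suc (suc k) , ≤-refl , ssk≤M , refl))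
              h = holeThrough F adj? S′ t∉S′ (left 0<k ≤-refl)
                    (Adj-sym F (HoleEdge⇒Adj F H (edge k))) (HoleEdge⇒Adj F H (edge (suc k)))
                    k≁ only′ detour
              u∉h : ¬ OnHole (HoleThrough.hole h) u
              u∉h on with HoleThrough.inside h on
              ... | inj₁ q = u≢t (trans q zk)
              ... | inj₂ (inj₁ (inj₁ a)) = arc-∌-base F H R (s≤s z≤n) k<N a
              ... | inj₂ (inj₁ (inj₂ a)) = arc-∌-base F H R (s≤s z≤n) M<N a
              ... | inj₂ (inj₂ p) = u∉P p

        -- Refuting the left arc yields a contact with `P` on it, and refuting the right arc then
        -- yields a second one; `not-both` excludes the two together.
        hole-side : ¬ ¬ Σ (Side t) λ s → Apart (S s) P
        hole-side none = none (leftSide , λ { (i , 0<i , i≤j , refl) py ty →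
          none (rightSide , λ { (i′ , j≤i′ , i′≤M , refl) py′ ty′ →
            not-both 0<i i≤j py ty j≤i′ i′≤M py′ ty′ }) })

    apart-side : ∀ {t} → Reach t → {P : Fin n → Set} → (∀ {x y} → P x → P y → Walk F P x y) →
      ¬ P u → (∀ {x} → P x → ¬ Touch F x t) → ¬ ¬ Σ (Side t) λ s → Apart (S s) P
    apart-side {t} r P-walk u∉P P∌t with adj? u t | r
    ... | yes u∼t | _ = λ none → none (trivialSide u∼t , λ { refl py ty → P∌t py (Touch-sym F ty) })
    ... | no u≁t | inj₁ u∼t = ⊥-elim (u≁t u∼t)
    ... | no u≁t | inj₂ (u≢t , H , u∈H , t∈H) = hole-side u≢t u≁t H u∈H t∈H P-walk u∉P P∌t

    -- Choose a side of `b` not touching `a`, then a side of `a` apart from it. Joined through `Y`,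
    -- they give a hole through `u` and both ends. Away from `u` that hole passes between two sides
    -- that do not touch, so it meets `Y`, and that vertex would be reached.
    reach-link : ∀ {a b} → Reach a → Reach b → ¬ Touch F a b →
      (Y : Fin n → Set) → ¬ Y u → (∀ {y} → Y y → ¬ Reach y) →
      ∀ {y y′} → Y y → Y y′ → Walk F Y y y′ → Adj F a y → Adj F y′ b → ⊥
    reach-link {a} {b} ra rb a≁b Y u∉Y unreached {y} {y′} Yy Yy′ w a∼y y′∼b =
      apart-side rb {_≡ a} (λ { refl refl → ε }) (λ q → Reach⇒≢ ra q) (λ { refl → a≁b })
        λ { (sb , sb-a) →
      apart-side ra {S sb} (walk sb) (u∉S sb) (λ p → sb-a p refl)
        λ { (sa , sa-sb) → finish sb sa sa-sb } }
      where
      finish : (sb : Side b) (sa : Side a) → Apart (S sa) (S sb) → ⊥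
      finish sb sa apart =
        let x , (on , _) , Yx = crossing in
        unreached Yx (inj₂ ((λ q → u∉Y (subst Y (≡-sym q) Yx)) , H , HoleEdge⇒OnHole F H (HoleThrough.edge₁ h) , on))
        where
        T : Fin n → Set
        T x = S sa x ⊎ Y x ⊎ S sb x
        u∉T : ¬ T u
        u∉T (inj₁ p) = u∉S sa p
        u∉T (inj₂ (inj₁ p)) = u∉Y p
        u∉T (inj₂ (inj₂ p)) = u∉S sb p
        only′ : ∀ x → T x → Adj F u x → x ≡ end sa ⊎ x ≡ end sb
        only′ x (inj₁ p) e = inj₁ (only sa p e)
        only′ x (inj₂ (inj₁ p)) e = ⊥-elim (unreached p (inj₁ e))
        only′ x (inj₂ (inj₂ p)) e = inj₂ (only sb p e)
        through : Walk F T (end sa) (end sb)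
        through = Walk-⊆ F inj₁ (walk sa (S-end sa) (S-t sa))
          ◅◅ touch-walk F (inj₁ (S-t sa)) (inj₂ (inj₁ Yy)) (inj₂ a∼y)
          ◅◅ Walk-⊆ F (inj₂ ∘ inj₁) w
          ◅◅ touch-walk F (inj₂ (inj₁ Yy′)) (inj₂ (inj₂ (S-t sb))) (inj₂ y′∼b)
          ◅◅ Walk-⊆ F (inj₂ ∘ inj₂) (walk sb (S-t sb) (S-end sb))
        h = holeThrough F adj? T u∉T (inj₁ (S-end sa)) (u∼end sa) (u∼end sb)
              (apart (S-end sa) (S-end sb)) only′ through
        H = HoleThrough.hole h
        end-on : OnHole H (end sa)
        end-on = HoleEdge⇒OnHole F H (HoleEdge-sym F H (HoleThrough.edge₁ h))
        crossing = walk-crosses F proj₂ apart (end-on , inj₁ (S-end sa)) (S-end sa) (S-end sb)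
          (HoleThrough.around h)

-- Local chordalization

module _ {n : ℕ} (F : Gr n) (u : Fin n) where

  private
    F′ = chordalizeAt F u

  Adj⇒chordalized : ∀ {x y} → Adj F x y → Adj F′ x y
  Adj⇒chordalized (vx , vy , x≢y , e) = vx , vy , x≢y , ⊎-map inj₁ inj₁ e

  chordalized⇒ : ∀ {x y} → Adj F′ x y → Adj F x y ⊎ (x ≡ u × Reach F u y) ⊎ (y ≡ u × Reach F u x)
  chordalized⇒ (vx , vy , x≢y , inj₁ (inj₁ e)) = inj₁ (vx , vy , x≢y , inj₁ e)
  chordalized⇒ (vx , vy , x≢y , inj₁ (inj₂ (refl , H , on))) = inj₂ (inj₁ (refl , inj₂ (x≢y , H , on)))
  chordalized⇒ (vx , vy , x≢y , inj₂ (inj₁ e)) = inj₁ (vx , vy , x≢y , inj₂ e)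
  chordalized⇒ (vx , vy , x≢y , inj₂ (inj₂ (refl , H , on))) =
    inj₂ (inj₂ (refl , inj₂ (x≢y ∘ ≡-sym , H , on)))

  chordalized⇒Reach : ∀ {y} → Adj F′ u y → Reach F u y
  chordalized⇒Reach e with chordalized⇒ e
  ... | inj₁ a = inj₁ a
  ... | inj₂ (inj₁ (_ , r)) = r
  ... | inj₂ (inj₂ (refl , _)) = ⊥-elim (proj₁ (proj₂ (proj₂ e)) refl)

  Reach⇒chordalized : ∀ {y} → Reach F u y → Adj F′ u y
  Reach⇒chordalized (inj₁ e) = Adj⇒chordalized e
  Reach⇒chordalized (inj₂ (u≢y , H , (i , refl) , (j , refl))) =
    inV H i , inV H j , u≢y , inj₁ (inj₂ (refl , H , (i , refl) , (j , refl)))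

  chordalized-away : ∀ {x y} → x ≢ u → y ≢ u → Adj F′ x y → Adj F x y
  chordalized-away x≢u y≢u e with chordalized⇒ e
  ... | inj₁ a = a
  ... | inj₂ (inj₁ (q , _)) = ⊥-elim (x≢u q)
  ... | inj₂ (inj₂ (q , _)) = ⊥-elim (y≢u q)

  -- Such a hole, with `u` removed, is a path of old edges. Its ends are reached, and its interior
  -- `Y` is not, because the hole is induced after chordalizing: `reach-link` forbids this.
  no-hole-through : (∀ x y → Dec (Adj F x y)) → NCvertex F u → (H : Hole F′) → ¬ OnHole H u
  no-hole-through adj? nc H u∈H = reach-link F u adj? nc
      (chordalized⇒Reach (subst (λ v → Adj F′ v (z 1)) z0 (HoleEdge⇒Adj F′ H (edge 0))))
      (chordalized⇒Reach (subst (λ v → Adj F′ v (z (3 + m))) (trans (cong z N≡) zN)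
        (Adj-sym F′ (HoleEdge⇒Adj F′ H (edge (3 + m))))))
      ends Y (λ Yu → arc-∌-base F′ H R (s≤s z≤n) hi<N Yu) unreached
      first last (walk-F (arc-walk F′ H R first last))
      (away 1 (s≤s z≤n) (≤-trans (s≤s (s≤s (s≤s z≤n))) (≤-reflexive N≡)))
      (away (2 + m) (s≤s z≤n) (≤-reflexive N≡))
    where
    R = rotation F′ H u∈H
    open Rotation R
    -- The length is `4 + m`: the neighbours of `u` have indices 1 and `3 + m`, and the interior
    -- runs from 2 to `2 + m`.
    m = len H ∸ 4
    N≡ : 4 + m ≡ len H
    N≡ = m+[n∸m]≡n (len≥4 H)
    Y = Arc F′ H R 2 (2 + m)
    hi<N : 2 + m < len H
    hi<N = ≤-trans (n≤1+n _) (≤-reflexive N≡)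
    first : Y (z 2)
    first = 2 , ≤-refl , s≤s (s≤s z≤n) , refl
    last : Y (z (2 + m))
    last = 2 + m , s≤s (s≤s z≤n) , ≤-refl , refl
    ≢u : ∀ {i} → 0 < i → i < len H → z i ≢ u
    ≢u 0<i i<N q = arc-∌-base F′ H R 0<i i<N (_ , ≤-refl , ≤-refl , q)
    away : ∀ i → 0 < i → suc i < len H → Adj F (z i) (z (suc i))
    away i 0<i i<N = chordalized-away (≢u 0<i (<⇒≤ i<N)) (≢u (s≤s z≤n) i<N) (HoleEdge⇒Adj F′ H (edge i))
    walk-F : ∀ {x y} → Walk F′ Y x y → Walk F Y x y
    walk-F ε = ε
    walk-F ((Yx@(_ , l , h , refl) , Yy@(_ , l′ , h′ , refl) , e) ◅ w) =
      (Yx , Yy , chordalized-away (≢u (≤-trans (s≤s z≤n) l) (≤-<-trans h hi<N))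
                                  (≢u (≤-trans (s≤s z≤n) l′) (≤-<-trans h′ hi<N)) e) ◅ walk-F w
    unreached : ∀ {y} → Y y → ¬ Reach F u y
    unreached (i , l , h , refl) r
      with adj-base F′ H R (≤-trans (s≤s z≤n) l) (≤-<-trans h hi<N) (Reach⇒chordalized r)
    ... | inj₁ q = <⇒≢ l (≡-sym q)
    ... | inj₂ q = <⇒≢ (s≤s (s≤s h)) (trans q (≡-sym N≡))
    1<N : 1 < len H
    1<N = ≤-trans (s≤s (s≤s z≤n)) (≤-reflexive N≡)
    3+m<N : 3 + m < len H
    3+m<N = ≤-reflexive N≡
    ends : ¬ Touch F (z 1) (z (3 + m))
    ends (inj₁ q) = <⇒≢ (s≤s (s≤s z≤n)) (inj-z 1<N 3+m<N q)
    ends (inj₂ e) with adj-z 1<N 3+m<N (Adj⇒chordalized e)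
    ... | inj₁ (inj₁ ())
    ... | inj₁ (inj₂ (_ , ()))
    ... | inj₂ (inj₁ ())
    ... | inj₂ (inj₂ (_ , ()))

-- Two centres and iterated chordalization

module _ {n : ℕ} where

  ¬¬-∀ : {P : Fin n → Set} → (∀ i → ¬ ¬ P i) → ¬ ¬ (∀ i → P i)
  ¬¬-∀ = sequence (RawMonad.rawApplicative ¬¬-Monad)

  ¬¬-Adj? : (F : Gr n) → ¬ ¬ (∀ x y → Dec (Adj F x y))
  ¬¬-Adj? F = ¬¬-∀ λ x → ¬¬-∀ λ y → ¬¬-excluded-middle

  module _ (F : Gr n) (adj? : ∀ x y → Dec (Adj F x y)) {u v : Fin n}
           (nc-u : NCvertex F u) (nc-v : NCvertex F v)
           (u∼v : Adj F u v) (separate : ∀ (H : Hole F) → OnHole H u → ¬ OnHole H v) where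

    square-free : ∀ {s t} → u ≢ s → v ≢ t → Adj F u t → Adj F v s → Adj F s t →
      ¬ Adj F u s → ¬ Adj F v t → ⊥
    square-free {s} {t} u≢s v≢t u∼t v∼s s∼t u≁s v≁t =
      separate hole (HoleEdge⇒OnHole F hole edge₁) (HoleEdge⇒OnHole F hole (HoleEdge-sym F hole edge₁))
      where
      S : Fin n → Set
      S x = x ≡ v ⊎ x ≡ s ⊎ x ≡ t
      irreflexive : ∀ {x y} → Adj F x y → x ≢ y
      irreflexive (_ , _ , x≢y , _) = x≢y
      only : ∀ x → S x → Adj F u x → x ≡ v ⊎ x ≡ t
      only x (inj₁ q) _ = inj₁ q
      only x (inj₂ (inj₁ refl)) e = ⊥-elim (u≁s e)
      only x (inj₂ (inj₂ q)) _ = inj₂ q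
      h = holeThrough F adj? S [ irreflexive u∼v , [ u≢s , irreflexive u∼t ] ]
        (inj₁ refl) u∼v u∼t [ v≢t , v≁t ] only
        ((inj₁ refl , inj₂ (inj₁ refl) , v∼s) ◅ (inj₂ (inj₁ refl) , inj₂ (inj₂ refl) , s∼t) ◅ ε)
      open HoleThrough h

    -- The two sides meet at `t` and may touch each other freely, since an induced path is extracted
    -- from their union. In that union together with `v`, the neighbours of `u` are only `v` and the
    -- end of its own side, so the resulting hole uses the edge from `u` to `v`.
    no-common-reach : ∀ {t} → Reach F u t → Reach F v t → ¬ Adj F u t → ¬ Adj F v t → ⊥
    no-common-reach {t} ru rv u≁t v≁t =
      apart-side F u adj? nc-u ru {_≡ v} (λ { refl refl → ε }) u≢v
        (λ { refl → [ Reach⇒≢ F v rv , v≁t ] }) λ { (a , a-v) →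
      apart-side F v adj? nc-v rv {_≡ u} (λ { refl refl → ε }) (u≢v ∘ ≡-sym)
        (λ { refl → [ Reach⇒≢ F u ru , u≁t ] }) λ { (b , b-u) → finish a b a-v b-u } }
      where
      u≢v : u ≢ v
      u≢v = proj₁ (proj₂ (proj₂ u∼v))
      finish : (a : Side F u t) (b : Side F v t) →
        Apart F u (Side.S a) (_≡ v) → Apart F v (Side.S b) (_≡ u) → ⊥
      finish a b a-v b-u =
        separate hole (HoleEdge⇒OnHole F hole edge₁) (HoleEdge⇒OnHole F hole (HoleEdge-sym F hole edge₂))
        where
        module A = Side a
        module B = Side b
        S : Fin n → Set
        S x = A.S x ⊎ B.S x ⊎ x ≡ v
        u∉ : ¬ S u
        u∉ (inj₁ p) = A.u∉S p
        u∉ (inj₂ (inj₁ p)) = b-u p refl (inj₁ refl)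
        u∉ (inj₂ (inj₂ q)) = u≢v q
        only : ∀ x → S x → Adj F u x → x ≡ A.end ⊎ x ≡ v
        only x (inj₁ p) e = inj₁ (A.only p e)
        only x (inj₂ (inj₁ p)) e = ⊥-elim (b-u p refl (inj₂ (Adj-sym F e)))
        only x (inj₂ (inj₂ q)) e = inj₂ q
        h = holeThrough F adj? S u∉ (inj₁ A.S-end) A.u∼end u∼v (a-v A.S-end refl) only
          ( Walk-⊆ F inj₁ (A.walk A.S-end A.S-t)
          ◅◅ Walk-⊆ F (inj₂ ∘ inj₁) (B.walk B.S-t B.S-end)
          ◅◅ (inj₂ (inj₁ B.S-end) , inj₂ (inj₂ refl) , Adj-sym F B.u∼end) ◅ ε)
        open HoleThrough h

  -- `hat` over an arbitrary list, so that induction on the list is possible.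
  hatOn : Gr n → Subset n → List (Fin n) → Gr n
  hatOn F D = foldl (λ F′ v → if lookupᵛ D v then chordalizeAt F′ v else F′) F

  V-hatOn : ∀ D xs F → V (hatOn F D xs) ≡ V F
  V-hatOn D [] F = refl
  V-hatOn D (v ∷ xs) F with lookupᵛ D v
  ... | true = V-hatOn D xs (chordalizeAt F v)
  ... | false = V-hatOn D xs F

  E⇒E-hatOn : ∀ D xs F {x y} → E F x y → E (hatOn F D xs) x y
  E⇒E-hatOn D [] F e = e
  E⇒E-hatOn D (v ∷ xs) F e with lookupᵛ D v
  ... | true = E⇒E-hatOn D xs (chordalizeAt F v) (inj₁ e)
  ... | false = E⇒E-hatOn D xs F e

  -- Stated for the raw relation, which outlives the current vertex set: an added pair lies on a
  -- hole, so both ends are vertices already.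
  E-hatOn⇒ : ∀ D xs F {x y} → E (hatOn F D xs) x y → E F x y ⊎ (V F x × V F y)
  E-hatOn⇒ D [] F e = inj₁ e
  E-hatOn⇒ D (v ∷ xs) F e with lookupᵛ D v
  ... | false = E-hatOn⇒ D xs F e
  ... | true with E-hatOn⇒ D xs (chordalizeAt F v) e
  ...   | inj₁ (inj₁ e′) = inj₁ e′
  ...   | inj₁ (inj₂ (refl , H , (i , refl) , (j , refl))) = inj₂ (inV H i , inV H j)
  ...   | inj₂ vs = inj₂ vs

  Spans : Gr n → Subset n → Fin n → Fin n → Set
  Spans F D x y = x ∈ D × Σ (Hole F) λ H → OnHole H x × OnHole H y

  module _ (F : Gr n) (u : Fin n) (adj? : ∀ x y → Dec (Adj F x y)) (nc : NCvertex F u) where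

    -- No hole passes through `u`, and away from `u` the adjacencies are unchanged.
    restrictHole : Hole (chordalizeAt F u) → Hole F
    restrictHole H = record
      { len = len H ; len≥4 = len≥4 H ; cyc = cyc H ; inj = inj H ; inV = inV H
      ; induced = λ i j → mk⇔
          (λ e → Equivalence.to (induced H i j) (Adj⇒chordalized F u e))
          (λ c → chordalized-away F u (≢u i) (≢u j) (Equivalence.from (induced H i j) c)) }
      where
      ≢u : ∀ i → cyc H i ≢ u
      ≢u i q = no-hole-through F u adj? nc H (i , q)

    restrictNC : ∀ {D} → NCset F D → NCset (chordalizeAt F u) D
    restrictNC (ncs , one) =
      (λ w w∈ H₁ H₂ → ncs w w∈ (restrictHole H₁) (restrictHole H₂)) , one ∘ restrictHole

    restrictSpans : ∀ {D x y} → Spans (chordalizeAt F u) D x y → Spans F D x y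
    restrictSpans (x∈ , H , on) = x∈ , restrictHole H , on

  -- Each step only loses holes, so the NC property persists and every hole used later is already a
  -- hole of the original graph.
  hatOn-adj : ∀ D xs F → NCset F D → ∀ {x y} → Adj (hatOn F D xs) x y →
    ¬ ¬ (Adj F x y ⊎ Spans F D x y ⊎ Spans F D y x)
  hatOn-adj D [] F nc e none = none (inj₁ e)
  hatOn-adj D (v ∷ xs) F nc {x} {y} e none with lookupᵛ D v in v∈
  ... | false = hatOn-adj D xs F nc e none
  ... | true = ¬¬-Adj? F λ adj? →
      hatOn-adj D xs (chordalizeAt F v) (restrictNC F v adj? nc-v nc) e (none ∘ collect adj?)
    where
    v∈D = lookup⇒[]= v D v∈
    nc-v = proj₁ nc v v∈D
    collect : (∀ x y → Dec (Adj F x y)) →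
      Adj (chordalizeAt F v) x y ⊎ Spans (chordalizeAt F v) D x y ⊎ Spans (chordalizeAt F v) D y x →
      Adj F x y ⊎ Spans F D x y ⊎ Spans F D y x
    collect adj? (inj₂ s) = inj₂ (⊎-map (restrictSpans F v adj? nc-v) (restrictSpans F v adj? nc-v) s)
    collect adj? (inj₁ (vx , vy , x≢y , inj₁ (inj₁ f))) = inj₁ (vx , vy , x≢y , inj₁ f)
    collect adj? (inj₁ (vx , vy , x≢y , inj₁ (inj₂ (refl , h)))) = inj₂ (inj₁ (v∈D , h))
    collect adj? (inj₁ (vx , vy , x≢y , inj₂ (inj₁ f))) = inj₁ (vx , vy , x≢y , inj₂ f)
    collect adj? (inj₁ (vx , vy , x≢y , inj₂ (inj₂ (refl , h)))) = inj₂ (inj₂ (v∈D , h))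

  -- Cliques of the chordalized graph

  module _ (F : Gr n) (D : Subset n) (nc : NCset F D) (K : Fin n → Set)
           (K-clique : ∀ {x y} → K x → K y → x ≢ y → Adj (hat F D) x y) where

    Defect : Fin n → Fin n → Set
    Defect u t = u ∈ D × K u × K t × ¬ Adj F u t × u ≢ t × Σ (Hole F) λ H → OnHole H u × OnHole H t

    private
      module _ (adj? : ∀ x y → Dec (Adj F x y)) where

        nonadjacent⇒defect : ∀ {x y} → K x → K y → x ≢ y → ¬ Adj F x y → ¬ ¬ (Defect x y ⊎ Defect y x)
        nonadjacent⇒defect kx ky x≢y x≁y none =
          hatOn-adj D (allFin n) F nc (K-clique kx ky x≢y) λ
            { (inj₁ e) → x≁y e
            ; (inj₂ (inj₁ (x∈D , h))) → none (inj₁ (x∈D , kx , ky , x≁y , x≢y , h))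
            ; (inj₂ (inj₂ (y∈D , H , ony , onx))) →
                none (inj₂ (y∈D , ky , kx , x≁y ∘ Adj-sym F , x≢y ∘ ≡-sym , H , ony , onx)) }

        Defect⇒Reach : ∀ {u t} → Defect u t → Reach F u t
        Defect⇒Reach (_ , _ , _ , _ , u≢t , h) = inj₂ (u≢t , h)

        -- The hole of the defect contains `u`, and it may contain only one vertex of `D`.
        Defect⇒∉ : ∀ {u t} → Defect u t → t ∉ D
        Defect⇒∉ (u∈D , _ , _ , _ , u≢t , H , onu , ont) t∈D =
          u≢t (proj₂ nc H _ _ u∈D t∈D onu ont)

        adjacent : ∀ {x y} → K x → K y → x ≢ y → ¬ Defect x y → ¬ Defect y x → Adj F x y
        adjacent {x} {y} kx ky x≢y ¬xy ¬yx with adj? x y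
        ... | yes e = e
        ... | no x≁y = ⊥-elim (nonadjacent⇒defect kx ky x≢y x≁y [ ¬xy , ¬yx ])

        -- If `u` misses `t` or `v` misses `s`, that pair is itself a defect, and both centres reach
        -- a common vertex adjacent to neither. Otherwise `u`, `v`, `s`, `t` form an induced square.
        defects-same-centre : ∀ {u v s t} → Defect u s → Defect v t → ¬ u ≢ v
        defects-same-centre {u} {v} {s} {t} us@(u∈ , ku , ks , u≁s , u≢s , _) vt@(v∈ , kv , kt , v≁t , v≢t , _) u≢v =
          clash (adj? u t) (adj? v s)
          where
          nc-u = proj₁ nc u u∈
          nc-v = proj₁ nc v v∈
          u∼v = adjacent ku kv u≢v (λ uv → Defect⇒∉ uv v∈) (λ vu → Defect⇒∉ vu u∈)
          separate : ∀ (H : Hole F) → OnHole H u → ¬ OnHole H v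
          separate H onu onv = u≢v (proj₂ nc H _ _ u∈ v∈ onu onv)
          clash : Dec (Adj F u t) → Dec (Adj F v s) → ⊥
          clash (no u≁t) _ = nonadjacent⇒defect ku kt (λ { refl → Defect⇒∉ vt u∈ }) u≁t λ
            { (inj₁ ut) → no-common-reach F adj? nc-u nc-v u∼v separate (Defect⇒Reach ut) (Defect⇒Reach vt) u≁t v≁t
            ; (inj₂ tu) → Defect⇒∉ tu u∈ }
          clash (yes _) (no v≁s) = nonadjacent⇒defect kv ks (λ { refl → Defect⇒∉ us v∈ }) v≁s λ
            { (inj₁ vs) → no-common-reach F adj? nc-u nc-v u∼v separate (Defect⇒Reach us) (Defect⇒Reach vs) u≁s v≁s
            ; (inj₂ sv) → Defect⇒∉ sv v∈ }
          clash (yes u∼t) (yes v∼s) =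
            square-free F adj? nc-u nc-v u∼v separate u≢s v≢t u∼t v∼s s∼t u≁s v≁t
            where
            s∼t = adjacent ks kt (λ { refl → u≁s u∼t })
              (λ st → Defect⇒∉ us (proj₁ st)) (λ ts → Defect⇒∉ vt (proj₁ ts))

    -- Without defects nothing is removed; otherwise the centre of one defect is the centre of all.
    clique-hat : ¬ ¬ ∃ λ (T : Subset n) → (∀ {x} → x ∈ T → K x × x ∈ D)
      × (∀ {x y} → x ∈ T → y ∈ T → x ≡ y)
      × (∀ {x y} → K x → K y → x ∉ T → y ∉ T → x ≢ y → Adj F x y)
    clique-hat none = ¬¬-Adj? F λ adj? → ¬¬-excluded-middle {A = ∃ λ u → ∃ (Defect u)} λ
      { (no ¬defect) → none (∅ , (λ x∈ → ⊥-elim (∉⊥ x∈)) , (λ x∈ → ⊥-elim (∉⊥ x∈)) ,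
          λ kx ky _ _ x≢y → adjacent adj? kx ky x≢y (λ d → ¬defect (_ , _ , d)) (λ d → ¬defect (_ , _ , d)))
      ; (yes (u , t , d)) → none (⁅ u ⁆ ,
          (λ x∈ → subst (λ w → K w × w ∈ D) (≡-sym (x∈⁅y⁆⇒x≡y u x∈)) (proj₁ (proj₂ d) , proj₁ d)) ,
          (λ x∈ y∈ → trans (x∈⁅y⁆⇒x≡y u x∈) (≡-sym (x∈⁅y⁆⇒x≡y u y∈))) ,
          λ kx ky x∉ y∉ x≢y → adjacent adj? kx ky x≢y
            (λ d′ → defects-same-centre adj? d d′ (λ { refl → x∉ (x∈⁅x⁆ u) }))
            (λ d′ → defects-same-centre adj? d d′ (λ { refl → y∉ (x∈⁅x⁆ u) }))) }

  -- The chordalization chain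

  module _ (G : SimpleGraph n) (C : Subset n) (ℓ : ℕ) (part : Fin ℓ → Subset n) (lcp : IsLCP G C ℓ part) where
    open Chain G C ℓ part

    private
      part⊆C : ∀ i → part i ⊆ C
      part⊆C = proj₁ (proj₂ lcp)

      parts-disjoint : ∀ i j x → x ∈ part i → x ∈ part j → i ≡ j
      parts-disjoint = proj₁ (proj₂ (proj₂ (proj₂ lcp)))

      partN-toℕ : ∀ i → partN (toℕ i) ≡ part i
      partN-toℕ i with toℕ i <? ℓ
      ... | yes p = cong part (fromℕ<-toℕ i p)
      ... | no ¬p = ⊥-elim (¬p (toℕ<n i))

      partN⇒part : ∀ {m x} → x ∈ partN m → ∃ λ j → toℕ j ≡ m × x ∈ part j
      partN⇒part {m} x∈ with m <? ℓ
      ... | yes p = fromℕ< p , toℕ-fromℕ< p , x∈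
      ... | no _ = ⊥-elim (∉⊥ x∈)

      V-hat : ∀ m {x} → V (Gstar (suc m)) x → V (Gi (suc m)) x
      V-hat m {x} = subst (λ P → P x) (V-hatOn (partN m) (allFin n) (Gi (suc m)))

      V-hat⁻ : ∀ m {x} → V (Gi (suc m)) x → V (Gstar (suc m)) x
      V-hat⁻ m {x} = subst (λ P → P x) (≡-sym (V-hatOn (partN m) (allFin n) (Gi (suc m))))

      V-Gstar : ∀ m {x} → V (Gstar m) x → x ∉ C ⊎ ∃ λ j → toℕ j < m × x ∈ part j
      V-Gstar zero x∉C = inj₁ x∉C
      V-Gstar (suc m) v with V-hat m v
      ... | inj₂ x∈ = let j , j≡m , x∈j = partN⇒part x∈ in
            inj₂ (j , subst (_< suc m) (≡-sym j≡m) (n<1+n m) , x∈j)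
      ... | inj₁ v′ with V-Gstar m v′
      ...   | inj₁ x∉C = inj₁ x∉C
      ...   | inj₂ (j , j<m , x∈j) = inj₂ (j , m<n⇒m<1+n j<m , x∈j)

      part∩V-Gstar : ∀ i {x} → x ∈ part i → ¬ V (Gstar (toℕ i)) x
      part∩V-Gstar i x∈ v with V-Gstar (toℕ i) v
      ... | inj₁ x∉C = x∉C (part⊆C i x∈)
      ... | inj₂ (j , j<i , x∈j) = <-irrefl (cong toℕ (parts-disjoint j i _ x∈j x∈)) j<i

      -- E is not restricted to V, so adding vertices could activate stray edges;
      -- those can only be edges of G.
      E-Gstar⇒ : ∀ m {x y} → E (Gstar m) x y → adj G x y ≡ true ⊎ (V (Gstar m) x × V (Gstar m) y)
      E-Gstar⇒ zero e = inj₁ e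
      E-Gstar⇒ (suc m) e with E-hatOn⇒ (partN m) (allFin n) (Gi (suc m)) e
      ... | inj₂ (vx , vy) = inj₂ (V-hat⁻ m vx , V-hat⁻ m vy)
      ... | inj₁ (inj₂ (e′ , _)) = inj₁ e′
      ... | inj₁ (inj₁ e′) with E-Gstar⇒ m e′
      ...   | inj₁ g = inj₁ g
      ...   | inj₂ (vx , vy) = inj₂ (V-hat⁻ m (inj₁ vx) , V-hat⁻ m (inj₁ vy))

      -- The raw relation of `G₀` contains every edge of `G`, even at absent vertices, so the edges
      -- adjoined in `Gi` are present beforehand.
      adj⇒E-Gstar : ∀ m {x y} → adj G x y ≡ true → E (Gstar m) x y
      adj⇒E-Gstar zero g = g
      adj⇒E-Gstar (suc m) g = E⇒E-hatOn (partN m) (allFin n) (Gi (suc m)) (inj₁ (adj⇒E-Gstar m g))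

      E-Gi⇒E-Gstar : ∀ m {x y} → E (Gi (suc m)) x y → E (Gstar m) x y
      E-Gi⇒E-Gstar m (inj₁ e) = e
      E-Gi⇒E-Gstar m (inj₂ (g , _)) = adj⇒E-Gstar m g

      symmetric : ∀ {x y} {A : Fin n → Fin n → Set} → (∀ {x y} → A x y → adj G x y ≡ true) →
        A x y ⊎ A y x → adj G x y ≡ true
      symmetric f (inj₁ a) = f a
      symmetric {x} {y} f (inj₂ a) = trans (sym G x y) (f a)

      -- Edges outside `G` join vertices of the preceding chordal graph, and `part i` is disjoint
      -- from those.
      new-vertex-edge : ∀ i {x y} → x ∈ part i ⊎ y ∈ part i →
        Adj (Gi (suc (toℕ i))) x y → adj G x y ≡ true
      new-vertex-edge i {x} {y} new (_ , _ , _ , inj₁ e) with E-Gstar⇒ (toℕ i) (E-Gi⇒E-Gstar (toℕ i) e)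
      ... | inj₁ g = g
      ... | inj₂ (vx , vy) = ⊥-elim ([ (λ p → part∩V-Gstar i p vx) , (λ p → part∩V-Gstar i p vy) ] new)
      new-vertex-edge i {x} {y} new (vx , vy , x≢y , inj₂ e) =
        trans (sym G x y) (new-vertex-edge i (swap new) (vy , vx , x≢y ∘ ≡-sym , inj₁ e))

      old-vertex : ∀ i {x} → V (Gi (suc (toℕ i))) x → x ∉ part i → V (Gstar (toℕ i)) x
      old-vertex i (inj₁ v) _ = v
      old-vertex i (inj₂ x∈) x∉ = ⊥-elim (x∉ (subst (_ ∈_) (partN-toℕ i) x∈))

      old-edge : ∀ i {x y} → x ∉ part i → y ∉ part i → Adj (Gi (suc (toℕ i))) x y → Adj (Gstar (toℕ i)) x y
      old-edge i x∉ y∉ (vx , vy , x≢y , e) = old-vertex i vx x∉ , old-vertex i vy y∉ , x≢y ,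
        ⊎-map (E-Gi⇒E-Gstar (toℕ i)) (E-Gi⇒E-Gstar (toℕ i)) e

    -- `K` is a predicate, so it can be cut down freely in the induction; `T` is a `Subset`, so its
    -- existence can be decided at the end.
    Transversal : (Fin n → Set) → Set
    Transversal K = ∃ λ (T : Subset n) → (∀ {x} → x ∈ T → K x × x ∈ C)
      × CliqueG G (λ x → K x × x ∉ T)
      × (∀ (i : Fin ℓ) x y → x ∈ T → y ∈ T → x ∈ part i → y ∈ part i → x ≡ y)

    private
      -- `clique-hat` removes at most one vertex of `part i`, and the induction hypothesis treats
      -- `K` outside `part i`. Surviving edges at `part i` belong to `G`, and the two removed sets
      -- never share a part.
      extend : ∀ i {K : Fin n → Set} →
        (∀ {x y} → K x → K y → x ≢ y → Adj (Gstar (suc (toℕ i))) x y) →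
        (∀ {K′ : Fin n → Set} → (∀ {x y} → K′ x → K′ y → x ≢ y → Adj (Gstar (toℕ i)) x y) →
          ¬ ¬ Transversal K′) →
        ¬ ¬ Transversal K
      extend i {K} K-clique ih none =
        clique-hat F D nc K K-clique λ { (T , T⊆ , T-one , T-rest) →
        ih {λ x → K x × x ∉ part i}
          (λ { (kx , x∉) (ky , y∉) x≢y → old-edge i x∉ y∉
            (T-rest kx ky (x∉ ∘ T⊆part T⊆) (y∉ ∘ T⊆part T⊆) x≢y) })
          λ { (T′ , T′⊆ , T′-rest , T′-one) → none (merge T T⊆ T-one T-rest T′ T′⊆ T′-rest T′-one) } }
        where
        F = Gi (suc (toℕ i))
        D = partN (toℕ i)
        nc : NCset F D
        nc = subst (NCset F) (≡-sym (partN-toℕ i)) (proj₁ (proj₂ (proj₂ (proj₂ (proj₂ (proj₂ lcp))) i)))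
        T⊆part : ∀ {T : Subset n} → (∀ {x} → x ∈ T → K x × x ∈ D) → ∀ {x} → x ∈ T → x ∈ part i
        T⊆part T⊆ x∈ = subst (_ ∈_) (partN-toℕ i) (proj₂ (T⊆ x∈))
        merge : ∀ T → (∀ {x} → x ∈ T → K x × x ∈ D) → (∀ {x y} → x ∈ T → y ∈ T → x ≡ y) →
          (∀ {x y} → K x → K y → x ∉ T → y ∉ T → x ≢ y → Adj F x y) →
          ∀ T′ → (∀ {x} → x ∈ T′ → (K x × x ∉ part i) × x ∈ C) →
          CliqueG G (λ x → (K x × x ∉ part i) × x ∉ T′) →
          (∀ (j : Fin ℓ) x y → x ∈ T′ → y ∈ T′ → x ∈ part j → y ∈ part j → x ≡ y) → Transversal K
        merge T T⊆ T-one T-rest T′ T′⊆ T′-rest T′-one =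
          T′ ∪ T , inside , clique , one
          where
          inside : ∀ {x} → x ∈ T′ ∪ T → K x × x ∈ C
          inside x∈ with x∈p∪q⁻ T′ T x∈
          ... | inj₁ p = let (kx , _) , x∈C = T′⊆ p in kx , x∈C
          ... | inj₂ p = proj₁ (T⊆ p) , part⊆C i (T⊆part T⊆ p)
          clique : CliqueG G (λ x → K x × x ∉ T′ ∪ T)
          clique x y (kx , x∉) (ky , y∉) x≢y
            with T-rest kx ky (x∉ ∘ x∈p∪q⁺ ∘ inj₂) (y∉ ∘ x∈p∪q⁺ ∘ inj₂) x≢y | x ∈? part i | y ∈? part i
          ... | e | yes x∈ | _ = new-vertex-edge i (inj₁ x∈) e
          ... | e | no _ | yes y∈ = new-vertex-edge i (inj₂ y∈) e
          ... | e | no x∉i | no y∉i =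
            T′-rest x y ((kx , x∉i) , x∉ ∘ x∈p∪q⁺ ∘ inj₁) ((ky , y∉i) , y∉ ∘ x∈p∪q⁺ ∘ inj₁) x≢y
          mixed : ∀ {j x y} → x ∈ T′ → y ∈ T → x ∈ part j → y ∈ part j → ⊥
          mixed {j} {x} {y} x∈ y∈ xj yj with parts-disjoint j i y yj (T⊆part T⊆ y∈)
          ... | refl = proj₂ (proj₁ (T′⊆ x∈)) xj
          one : ∀ (j : Fin ℓ) x y → x ∈ T′ ∪ T → y ∈ T′ ∪ T → x ∈ part j → y ∈ part j → x ≡ y
          one j x y x∈ y∈ xj yj with x∈p∪q⁻ T′ T x∈ | x∈p∪q⁻ T′ T y∈
          ... | inj₁ p | inj₁ q = T′-one j x y p q xj yj
          ... | inj₂ p | inj₂ q = T-one p q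
          ... | inj₁ p | inj₂ q = ⊥-elim (mixed p q xj yj)
          ... | inj₂ p | inj₁ q = ⊥-elim (mixed q p yj xj)

    clique-Gstar : ∀ m → (∀ {k} → k < m → k < ℓ) → {K : Fin n → Set} →
      (∀ {x y} → K x → K y → x ≢ y → Adj (Gstar m) x y) → ¬ ¬ Transversal K
    clique-Gstar zero _ K-clique none = none
      (∅ , (λ x∈ → ⊥-elim (∉⊥ x∈)) ,
        (λ { x y (kx , _) (ky , _) x≢y →
          symmetric {A = λ x y → adj G x y ≡ true} (λ g → g) (proj₂ (proj₂ (proj₂ (K-clique kx ky x≢y)))) }) ,
        λ i x y x∈ → ⊥-elim (∉⊥ x∈))
    clique-Gstar (suc m) m<ℓ = at (fromℕ< (m<ℓ (n<1+n m))) (toℕ-fromℕ< (m<ℓ (n<1+n m)))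
        (clique-Gstar m (m<ℓ ∘ m<n⇒m<1+n))
      where
      Holds : ℕ → Set₁
      Holds k = ∀ {K : Fin n → Set} →
        (∀ {x y} → K x → K y → x ≢ y → Adj (Gstar k) x y) → ¬ ¬ Transversal K
      -- `extend` is indexed by `Fin ℓ`; the equation moves it to natural number stages.
      at : ∀ i {k} → toℕ i ≡ k → Holds k → Holds (suc k)
      at i refl ih K-clique = extend i K-clique ih

theorem4p7 : ∀ {n} (G : SimpleGraph n) (C : Subset n) (ℓ : ℕ) (part : Fin ℓ → Subset n)
    → IsLCP G C ℓ part
    → (K : Subset n)
    → CliqueGr (Chain.Gstar G C ℓ part ℓ) K
    → ∃ λ (C* : Subset n) → C* ⊆ K ∩ C
    × CliqueG G (λ x → x ∈ K × x ∉ C*)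
    × (∀ (i : Fin ℓ) x y → x ∈ C* → y ∈ C* → x ∈ part i → y ∈ part i → x ≡ y)
-- The subsets can be searched exhaustively, so it suffices to refute that none works.
theorem4p7 G C ℓ part lcp K K-clique = decidable-stable
  (anySubset? λ C* → (C* ⊆? K ∩ C)
    ×-dec all? (λ x → all? λ y → ((x ∈? K) ×-dec ¬? (x ∈? C*)) →-dec ((y ∈? K) ×-dec ¬? (y ∈? C*))
      →-dec ¬? (x ≟ᶠ y) →-dec (adj G x y ≟ᵇ true))
    ×-dec all? (λ i → all? λ x → all? λ y → (x ∈? C*) →-dec (y ∈? C*)
      →-dec (x ∈? part i) →-dec (y ∈? part i) →-dec (x ≟ᶠ y)))
  λ none → clique-Gstar G C ℓ part lcp ℓ (λ k<ℓ → k<ℓ) {_∈ K} (λ {x} {y} → K-clique x y)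
    λ { (T , T⊆ , rest) → none (T , (λ x∈ → x∈p∩q⁺ (T⊆ x∈)) , rest) }
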